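{- Let $a\ge1$ be an even integer, $b\ge1$ an odd integer, and $n>1$ an odd integer. Then the Horadam cube $\Pi^{a,b}_n$ is Hamiltonian.
   Context: For integers $a,b\ge1$ and $n\ge 0$, $\mathcal S^{a,b}_n$ is the set of all strings of length $n$ over the alphabet $\{0,1,\dots,a+b-1\}$ in which every letter from $\{a,\dots,a+b-1\}$ appears only immediately after a letter $0$. The Horadam cube $\Pi^{a,b}_n$ is the simple graph with vertex set $\mathcal S^{a,b}_n$ in which $x_1\cdots x_n$ and $y_1\cdots y_n$ are adjacent if and only if $\sum_{i=1}^n|x_i-y_i|=1$. A graph is Hamiltonian if it contains a cycle visiting each vertex exactly once. -}

module Defs where

open import Data.Fin.Base using (Fin; toℕ)
open import Data.List.Base using (List; _∷_; _∷ʳ_; length)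
open import Data.List.Membership.Propositional using (_∈_)
open import Data.List.Relation.Unary.Linked using (Linked)
open import Data.List.Relation.Unary.Unique.Propositional using (Unique)
open import Data.Nat.Base using (ℕ; suc; _+_; _≤_; ∣_-_∣)
open import Data.Nat.Properties using (∣-∣-comm; ∣n-n∣≡0; 0≢1+n)
open import Data.Product.Base using (∃-syntax; _×_)
open import Data.Refinement.Base using (Refinement-syntax; value)
open import Data.Vec.Base using (Vec; []; _∷_; lookup; sum; zipWith)
open import Level using (0ℓ)
open import Relation.Binary.Core using (Rel)
open import Relation.Binary.Definitions using (Symmetric; Irreflexive)
open import Relation.Binary.PropositionalEquality
  using (_≡_; refl; sym; trans; cong₂)

record SimpleGraph : Set₁ where
  field
    Vertex  : Set
    Adj     : Rel Vertex 0ℓ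
    symm    : Symmetric Adj
    irrefl  : Irreflexive _≡_ Adj

module _ (G : SimpleGraph) where
  open SimpleGraph G

  -- The cycle v₀ v₁ … v_{k-1} v₀ is given by v₀ and the list v₁ … v_{k-1}.
  record IsCycle (v : Vertex) (vs : List Vertex) : Set where
    field
      atLeast3 : 3 ≤ length (v ∷ vs)
      distinct : Unique (v ∷ vs)
      closed   : Linked Adj (v ∷ vs ∷ʳ v)

  Hamiltonian : Set
  Hamiltonian = ∃[ v ] ∃[ vs ] IsCycle v vs × (∀ u → u ∈ v ∷ vs)

Word : ℕ → ℕ → ℕ → Set
Word a b n = Vec (Fin (a + b)) n

HoradamWord : ∀ a b {n} → Word a b n → Set
HoradamWord a b {n} x =
  ∀ (i : Fin n) → a ≤ toℕ (lookup x i) →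
  ∃[ j ] toℕ i ≡ suc (toℕ j) × toℕ (lookup x j) ≡ 0

-- The membership proof is irrelevant in a refinement type, so equality in
-- 𝒮 a b n is equality of the underlying words.
𝒮 : ℕ → ℕ → ℕ → Set
𝒮 a b n = [ x ∈ Word a b n ∣ HoradamWord a b x ]

dist : ∀ {m n} → Vec (Fin m) n → Vec (Fin m) n → ℕ
dist x y = sum (zipWith (λ xᵢ yᵢ → ∣ toℕ xᵢ - toℕ yᵢ ∣) x y)

dist-comm : ∀ {m n} (x y : Vec (Fin m) n) → dist x y ≡ dist y x
dist-comm []      []      = refl
dist-comm (i ∷ x) (j ∷ y) =
  cong₂ _+_ (∣-∣-comm (toℕ i) (toℕ j)) (dist-comm x y)

dist-self : ∀ {m n} (x : Vec (Fin m) n) → dist x x ≡ 0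
dist-self []      = refl
dist-self (i ∷ x) = cong₂ _+_ (∣n-n∣≡0 (toℕ i)) (dist-self x)

Π-cube : ℕ → ℕ → ℕ → SimpleGraph
Π-cube a b n = record
  { Vertex = 𝒮 a b n
  ; Adj    = λ x y → dist (value x) (value y) ≡ 1
  ; symm   = λ {x} {y} xy → trans (dist-comm (value y) (value x)) xy
  ; irrefl = λ { {x} refl xx → 0≢1+n (trans (sym (dist-self (value x))) xx) }
  }

{-# OPTIONS --safe #-}
-- Let G k be the list of the words of length k obtained by traversing c·G (k−1) for
-- c = a−1, …, 0, alternately forwards and backwards, and then 0c·G (k−2) for
-- c = a, …, a+b−1 likewise.  As a is even, the first part ends at 0(a−1)·w with w the
-- first word of G (k−2), so G k is a Hamiltonian path; it starts with (a−1)·G (k−1).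
--
-- For n odd, arrange the words starting with a letter below a as an a × |G (n−1)|
-- grid.  The grid has a Hamiltonian cycle containing the whole row 0·G (n−1),
-- which starts with 0(a−1)·G (n−2).  Since G (n−2) has even length, it splits into
-- consecutive pairs w, w′, and each edge 0(a−1)w — 0(a−1)w′ can be replaced by the detour
-- 0(a−1)w, 0aw, …, 0(a+b−1)w, 0(a+b−1)w′, …, 0aw′, 0(a−1)w′ through the remaining words.
module Submission where

open import Defs
open import Data.Empty using (⊥-elim-irr)
open import Data.Fin.Base
  using (Fin; zero; suc; toℕ; fromℕ; inject₁; opposite; _↑ˡ_; _↑ʳ_; splitAt)
open import Data.Fin.Properties
  using (toℕ-↑ˡ; toℕ-↑ʳ; toℕ<n; toℕ-fromℕ; ↑ˡ-injective; ↑ʳ-injective;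
         splitAt⁻¹-↑ˡ; splitAt⁻¹-↑ʳ; opposite-involutive)
open import Data.Irrelevant using () renaming ([_] to irr)
open import Data.List.Base
  using (List; []; _∷_; [_]; _++_; map; reverse; length; cartesianProductWith; allFin; tabulate)
open import Data.List.Membership.Propositional using (_∈_)
open import Data.List.Membership.Propositional.Properties
  using (∈-cartesianProductWith⁺; ∈-cartesianProductWith⁻; ∈-++⁺ˡ; ∈-++⁺ʳ; ∈-allFin; ∈-tabulate⁺)
open import Data.List.Properties
  using (++-assoc; ++-identityʳ; map-++; map-∘; map-tabulate; length-map;
         length-reverse; length-tabulate; length-++; unfold-reverse)
open import Data.List.Relation.Binary.Permutation.Propositional
  using (_↭_; ↭-refl; ↭-sym; ↭-trans; ↭-reflexive; ↭⇒↭ₛ; module PermutationReasoning)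
open import Data.List.Relation.Binary.Permutation.Propositional.Properties
  using (∈-resp-↭; ↭-reverse; ++-comm; shifts)
  renaming (++⁺ to ↭-++⁺; ++⁺ˡ to ↭-++⁺ˡ; map⁺ to ↭-map⁺)
import Data.List.Relation.Binary.Permutation.Setoid.Properties as Permutationₛ
open import Data.List.Relation.Unary.All using ([])
open import Data.List.Relation.Unary.AllPairs using ([]; _∷_)
open import Data.List.Relation.Unary.Any using (here)
open import Data.List.Relation.Unary.Linked using (Linked; [-]; _∷_)
open import Data.List.Relation.Unary.Unique.Propositional using (Unique)
import Data.List.Relation.Unary.Unique.Propositional.Properties as Unique
open import Data.Nat.Base using (ℕ; zero; suc; parity; _+_; _*_; _≤_; _<_; ∣_-_∣; z≤n; s≤s)
open import Data.Nat.Properties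
  using (<⇒≱; m≤m+n; ∣n-n∣≡0; ∣-∣-comm; ∣m+n-m+o∣≡∣n-o∣; +-identityʳ; +-suc; +-mono-≤)
  renaming (suc-injective to ℕ-suc-injective)
open import Data.Parity.Base using (Parity; 0ℙ; 1ℙ; _⁻¹)
import Data.Parity.Base as Parity
open import Data.Parity.Properties using (suc-homo-⁻¹; +-homo-+; *-homo-*)
open import Data.Product.Base using (∃-syntax; _×_; _,_; proj₁; proj₂)
open import Data.Refinement.Base using (value; _,_)
open import Data.Refinement.Properties using (value-injective)
open import Data.Sum.Base using (inj₁; inj₂)
open import Data.Vec.Base using ([]; _∷_)
open import Data.Vec.Properties using (∷-injective; ∷-injectiveˡ; ∷-injectiveʳ)
open import Function.Base using (_∘_; flip; id)
open import Level using (0ℓ)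
open import Relation.Binary.Core using (Rel)
open import Relation.Binary.Definitions using (Symmetric)
open import Relation.Binary.PropositionalEquality
  using (_≡_; _≢_; refl; sym; trans; cong; cong₂; subst; setoid; module ≡-Reasoning)
open import Relation.Nullary using (¬_; contradiction)

-- Lists that contain every element exactly once

module _ {A : Set} where

  record Enumerates (xs : List A) : Set where
    constructor enumerates
    field
      unique   : Unique xs
      complete : ∀ x → x ∈ xs

  Enumerates-resp-↭ : ∀ {xs ys} → xs ↭ ys → Enumerates xs → Enumerates ys
  Enumerates-resp-↭ p (enumerates u c) =
    enumerates (Permutationₛ.Unique-resp-↭ (setoid A) (↭⇒↭ₛ p) u) (∈-resp-↭ p ∘ c)

Enumerates-allFin : ∀ n → Enumerates (allFin n)
Enumerates-allFin n = enumerates (Unique.allFin⁺ n) ∈-allFin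

-- Concatenations, products and snakes up to permutation

module _ {A : Set} where

  -- In the cycle, `xs` are the words with a letter at least `a`, which are visited in the middle of
  -- row 0 and have to be moved behind all others.
  ++-rotate : ∀ (ws xs ys zs : List A) →
    ((ws ++ xs) ++ ys) ++ zs ↭ ((ws ++ ys) ++ zs) ++ xs
  ++-rotate ws xs ys zs = begin
    ((ws ++ xs) ++ ys) ++ zs ≡⟨ ++-assoc (ws ++ xs) ys zs ⟩
    (ws ++ xs) ++ ys ++ zs   ≡⟨ ++-assoc ws xs (ys ++ zs) ⟩
    ws ++ xs ++ ys ++ zs     ↭⟨ ↭-++⁺ˡ ws (++-comm xs (ys ++ zs)) ⟩
    ws ++ (ys ++ zs) ++ xs   ≡⟨ ++-assoc ws (ys ++ zs) xs ⟨
    (ws ++ ys ++ zs) ++ xs   ≡⟨ cong (_++ xs) (++-assoc ws ys zs) ⟨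
    ((ws ++ ys) ++ zs) ++ xs ∎
    where open PermutationReasoning

module _ {A B C : Set} where

  -- Splits the grid by its first column instead of its first row; the cycle uses that column as its
  -- way back.
  cartesianProductWith-∷ʳ : ∀ (f : A → B → C) xs y ys →
    cartesianProductWith f xs (y ∷ ys) ↭ map (λ x → f x y) xs ++ cartesianProductWith f xs ys
  cartesianProductWith-∷ʳ f []       y ys = ↭-refl
  cartesianProductWith-∷ʳ f (x ∷ xs) y ys = _↭_.prep _ (↭-trans
    (↭-++⁺ˡ (map (f x) ys) (cartesianProductWith-∷ʳ f xs y ys))
    (shifts (map (f x) ys) (map (λ x → f x y) xs)))

  cartesianProductWith-[]ʳ : ∀ (f : A → B → C) xs → cartesianProductWith f xs [] ≡ []
  cartesianProductWith-[]ʳ f []       = refl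
  cartesianProductWith-[]ʳ f (x ∷ xs) = cartesianProductWith-[]ʳ f xs

  cartesianProductWith-congʳ : ∀ (f : A → B → C) xs {ys zs} → ys ↭ zs →
    cartesianProductWith f xs ys ↭ cartesianProductWith f xs zs
  cartesianProductWith-congʳ f []       p = ↭-refl
  cartesianProductWith-congʳ f (x ∷ xs) p =
    ↭-++⁺ (↭-map⁺ (f x) p) (cartesianProductWith-congʳ f xs p)

  cartesianProductWith-map : ∀ {D : Set} (f : A → B → C) (g : D → A) xs ys →
    cartesianProductWith f (map g xs) ys ≡ cartesianProductWith (f ∘ g) xs ys
  cartesianProductWith-map f g []       ys = refl
  cartesianProductWith-map f g (x ∷ xs) ys =
    cong (map (f (g x)) ys ++_) (cartesianProductWith-map f g xs ys)

  -- The boustrophedon order of a grid: each row starts in the column in which the previous row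
  -- ended.
  snake : (A → B → C) → List A → List B → List C
  snake f []       ys = []
  snake f (x ∷ xs) ys = map (f x) ys ++ snake f xs (reverse ys)

  snake-↭ : ∀ f xs ys → snake f xs ys ↭ cartesianProductWith f xs ys
  snake-↭ f []       ys = ↭-refl
  snake-↭ f (x ∷ xs) ys = ↭-++⁺ˡ (map (f x) ys)
    (↭-trans (snake-↭ f xs (reverse ys)) (cartesianProductWith-congʳ f xs (↭-reverse ys)))

  length-snake : ∀ f xs ys → length (snake f xs ys) ≡ length xs * length ys
  length-snake f []       ys = refl
  length-snake f (x ∷ xs) ys = trans (length-++ (map (f x) ys)) (cong₂ _+_
    (length-map (f x) ys)
    (trans (length-snake f xs (reverse ys)) (cong (length xs *_) (length-reverse ys))))

cartesianProductWith-flip : ∀ {A B C : Set} (f : A → B → C) xs ys →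
  cartesianProductWith (flip f) ys xs ↭ cartesianProductWith f xs ys
cartesianProductWith-flip f xs []       = ↭-reflexive (sym (cartesianProductWith-[]ʳ f xs))
cartesianProductWith-flip f xs (y ∷ ys) = ↭-trans
  (↭-++⁺ˡ (map (λ x → f x y) xs) (cartesianProductWith-flip f xs ys))
  (↭-sym (cartesianProductWith-∷ʳ f xs y ys))

-- Paths with prescribed ends and vertex lists

data Path {A : Set} (R : Rel A 0ℓ) : A → A → List A → Set where
  single : ∀ {x} → Path R x x [ x ]
  cons   : ∀ {x y z xs} → R x y → Path R y z xs → Path R x z (x ∷ xs)

module _ {A : Set} {R : Rel A 0ℓ} where

  path-++ : ∀ {w x y z xs ys} → Path R w x xs → R x y → Path R y z ys → Path R w z (xs ++ ys)
  path-++ single     r q = cons r q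
  path-++ (cons s p) r q = cons s (path-++ p r q)

  path-reverse : Symmetric R → ∀ {x y xs} → Path R x y xs → Path R y x (reverse xs)
  path-reverse R-sym single = single
  path-reverse R-sym (cons {x = x} {xs = xs} r p) = subst (Path R _ _) (sym (unfold-reverse x xs))
    (path-++ (path-reverse R-sym p) (R-sym r) single)

  -- The old and the new prefix both end at `y`, so the edge by which the given path leaves the old
  -- prefix also leaves the new one.
  path-replace-prefix : ∀ {v w x y z xs xs′ ys} →
    Path R x y xs → Path R w y xs′ → Path R v z (xs ++ ys) → Path R w z (xs′ ++ ys)
  path-replace-prefix {xs′ = xs′} single p′ single = subst (Path R _ _) (sym (++-identityʳ xs′)) p′
  path-replace-prefix single     p′ (cons r q) = path-++ p′ r q
  -- The first edge of `q` can be removed only once the rest of the prefix is seen to be nonempty;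
  -- `replace-tail` therefore inspects `p` first.
  path-replace-prefix (cons _ p) p′ q          = replace-tail p p′ q
    where
    replace-tail : ∀ {u v w x y z xs xs′ ys} →
      Path R x y xs → Path R w y xs′ → Path R v z (u ∷ xs ++ ys) → Path R w z (xs′ ++ ys)
    replace-tail single     p′ (cons _ q) = path-replace-prefix single p′ q
    replace-tail (cons r p) p′ (cons _ q) = path-replace-prefix (cons r p) p′ q

  path-starts-at-head : ∀ {x y z xs} → Path R x z (y ∷ xs) → x ≡ y
  path-starts-at-head single     = refl
  path-starts-at-head (cons _ _) = refl

  path-nonempty : ∀ {x y xs} → Path R x y xs → ∃[ ys ] xs ≡ x ∷ ys
  path-nonempty single     = _ , refl
  path-nonempty (cons _ _) = _ , refl

  path-tail : ∀ {x y z v xs} → Path R x z (v ∷ y ∷ xs) → Path R y z (y ∷ xs)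
  path-tail (cons _ p) = subst (λ x → Path R x _ _) (path-starts-at-head p) p

  1≤path-length : ∀ {x y xs} → Path R x y xs → 1 ≤ length xs
  1≤path-length single     = s≤s z≤n
  1≤path-length (cons _ _) = s≤s z≤n

  path-linked : ∀ {x y xs} → Path R x y xs → Linked R xs
  path-linked single                = [-]
  path-linked (cons r single)       = r ∷ [-]
  path-linked (cons r p@(cons _ _)) = r ∷ path-linked p

  path-tabulate : ∀ m (f : Fin (suc m) → A) → (∀ i → R (f (inject₁ i)) (f (suc i))) →
    Path R (f zero) (f (fromℕ m)) (tabulate f)
  path-tabulate zero    f r = single
  path-tabulate (suc m) f r = cons (r zero) (path-tabulate m (f ∘ suc) (r ∘ suc))

path-map : ∀ {A B : Set} {R : Rel A 0ℓ} {S : Rel B 0ℓ} (f : A → B) →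
  (∀ x y → R x y → S (f x) (f y)) →
  ∀ {x y xs} → Path R x y xs → Path S (f x) (f y) (map f xs)
path-map f f-mono single     = single
path-map f f-mono (cons r p) = cons (f-mono _ _ r) (path-map f f-mono p)

-- Paths through snakes

pick : {A : Set} → Parity → A → A → A
pick 0ℙ x y = x
pick 1ℙ x y = y

pick-flip : ∀ {A : Set} n {x y : A} → pick (parity n) y x ≡ pick (parity (suc n)) x y
pick-flip zero          = refl
pick-flip (suc zero)    = refl
pick-flip (suc (suc n)) = pick-flip n

module _ {A B C : Set} {R : Rel A 0ℓ} {S : Rel B 0ℓ} {Q : Rel C 0ℓ}
         (S-sym : Symmetric S) (f : A → B → C)
         (f-monoˡ : ∀ x y z → R x y → Q (f x z) (f y z))
         (f-monoʳ : ∀ z x y → S x y → Q (f z x) (f z y)) where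

  -- Each row exchanges the two ends of `ys`, so the parity of the number of rows decides in which
  -- column the snake stops. Passing this parity through an equation lets `pick` reduce as soon as
  -- `t` is a constant.
  path-snake : ∀ {x y xs p q ys t} → parity (length xs) ≡ t → Path R x y xs → Path S p q ys →
    Path Q (f x p) (f y (pick t p q)) (snake f xs ys)
  path-snake {x} {ys = ys} refl single π =
    subst (Path Q _ _) (sym (++-identityʳ (map (f x) ys))) (path-map (f x) (f-monoʳ x) π)
  path-snake {x} {y} {p = p} {q} refl (cons {xs = xs} r ρ) π =
    subst (λ z → Path Q _ (f y z) _) (pick-flip (length xs))
      (path-++ (path-map (f x) (f-monoʳ x) π) (f-monoˡ _ _ q r)
               (path-snake refl ρ (path-reverse S-sym π)))

-- Hamiltonian cycles from Hamiltonian paths with adjacent ends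

hamiltonian : ∀ G {v w xs} →
  Path (SimpleGraph.Adj G) v w xs → SimpleGraph.Adj G w v → 3 ≤ length xs → Enumerates xs → Hamiltonian G
hamiltonian G {v} p w~v 3≤ (enumerates u c) with xs′ , refl ← path-nonempty p =
  v , xs′ , record { atLeast3 = 3≤ ; distinct = u ; closed = path-linked (path-++ p w~v single) } , c

-- Consecutive letters in ascending and descending order

Consecutive : ∀ {n} → Rel (Fin n) 0ℓ
Consecutive i j = ∣ toℕ i - toℕ j ∣ ≡ 1

consecutive-sym : ∀ {n} → Symmetric (Consecutive {n})
consecutive-sym {_} {i} {j} = trans (∣-∣-comm (toℕ j) (toℕ i))

consecutive-suc : ∀ {n} (i : Fin n) → Consecutive (inject₁ i) (suc i)
consecutive-suc zero    = refl
consecutive-suc (suc i) = consecutive-suc i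

opposite-inject₁ : ∀ {n} (i : Fin n) → opposite (inject₁ i) ≡ suc (opposite i)
opposite-inject₁ zero    = refl
opposite-inject₁ (suc i) = cong inject₁ (opposite-inject₁ i)

opposite-fromℕ : ∀ n → opposite (fromℕ n) ≡ zero
opposite-fromℕ zero    = refl
opposite-fromℕ (suc n) = cong inject₁ (opposite-fromℕ n)

opposite-injective : ∀ {n} {i j : Fin n} → opposite i ≡ opposite j → i ≡ j
opposite-injective {_} {i} {j} eq =
  trans (sym (opposite-involutive i)) (trans (cong opposite eq) (opposite-involutive j))

-- Descending order makes 0 the last first letter, which is where the words beginning with 0 and a
-- letter at least `a` can be attached.
descending : ∀ n → List (Fin n)
descending n = tabulate opposite

path-descending : ∀ n → Path Consecutive (fromℕ n) zero (descending (suc n))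
path-descending n = subst (λ i → Path Consecutive (fromℕ n) i (descending (suc n))) (opposite-fromℕ n)
  (path-tabulate n opposite λ i → subst (λ j → Consecutive j (inject₁ (opposite i)))
    (sym (opposite-inject₁ i))
    (consecutive-sym {x = inject₁ (opposite i)} (consecutive-suc (opposite i))))

Enumerates-descending : ∀ n → Enumerates (descending n)
Enumerates-descending n = enumerates (Unique.tabulate⁺ opposite-injective)
  (λ i → subst (_∈ descending n) (opposite-involutive i) (∈-tabulate⁺ (opposite i)))

-- Horadam words and their unique decomposition

module Cube (a′ b′ : ℕ) where

  a b : ℕ
  a = suc a′
  b = suc b′

  Adj : ∀ k → Rel (𝒮 a b k) 0ℓ
  Adj k = SimpleGraph.Adj (Π-cube a b k)

  Adj-sym : ∀ {k} → Symmetric (Adj k)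
  Adj-sym {k} {u} {v} = SimpleGraph.symm (Π-cube a b k) {u} {v}

  ε : 𝒮 a b 0
  ε = [] , irr λ ()

  a≰low : ∀ (c : Fin a) → ¬ a ≤ toℕ (c ↑ˡ b)
  a≰low c a≤c = <⇒≱ (toℕ<n c) (subst (a ≤_) (toℕ-↑ˡ c b) a≤c)

  a≤high : ∀ (j : Fin b) → a ≤ toℕ (a ↑ʳ j)
  a≤high j = subst (a ≤_) (sym (toℕ-↑ʳ a j)) (m≤m+n a (toℕ j))

  small-Horadam : ∀ {k} c {w : Word a b k} → HoradamWord a b w → HoradamWord a b ((c ↑ˡ b) ∷ w)
  small-Horadam c p zero    a≤ = contradiction a≤ (a≰low c)
  small-Horadam c p (suc i) a≤ with j , eq , z ← p i a≤ = suc j , cong suc eq , z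

  -- Only the letter right after `x` could depend on `x`, and that letter is below `a`.
  small-Horadam⁻ : ∀ {k} {x} c {w : Word a b k} →
    HoradamWord a b (x ∷ (c ↑ˡ b) ∷ w) → HoradamWord a b ((c ↑ˡ b) ∷ w)
  small-Horadam⁻ c p zero    a≤ = contradiction a≤ (a≰low c)
  small-Horadam⁻ c p (suc i) a≤ with suc j , eq , z ← p (suc (suc i)) a≤ =
    j , ℕ-suc-injective eq , z

  big-Horadam : ∀ {k} j {w : Word a b k} → HoradamWord a b w →
    HoradamWord a b (zero ∷ (a ↑ʳ j) ∷ w)
  big-Horadam j p (suc zero)    a≤ = zero , refl , refl
  big-Horadam j p (suc (suc i)) a≤ with l , eq , z ← p i a≤ = suc (suc l) , cong (2 +_) eq , z

  -- The first letter of `w` cannot owe its place to `a ↑ʳ j`, since `a` is a successor and this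
  -- letter is thus not 0.
  big-Horadam⁻ : ∀ {k} {x} j {w : Word a b k} → HoradamWord a b (x ∷ (a ↑ʳ j) ∷ w) →
    HoradamWord a b w
  big-Horadam⁻ j p i a≤ with p (suc (suc i)) a≤
  ... | suc (suc l) , eq , z = l , ℕ-suc-injective (ℕ-suc-injective eq) , z

  high-head : ∀ {k} j {w : Word a b k} → ¬ HoradamWord a b ((a ↑ʳ j) ∷ w)
  high-head j p with () ← proj₁ (proj₂ (p zero (a≤high j)))

  nonzero-high : ∀ {k} c j {w : Word a b k} → ¬ HoradamWord a b (suc c ∷ (a ↑ʳ j) ∷ w)
  nonzero-high c j p with zero , _ , () ← p (suc zero) (a≤high j)

  small : ∀ {k} → Fin a → 𝒮 a b k → 𝒮 a b (suc k)
  small c (w , irr p) = (c ↑ˡ b) ∷ w , irr (small-Horadam c p)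

  big : ∀ {k} → Fin b → 𝒮 a b k → 𝒮 a b (suc (suc k))
  big j (w , irr p) = zero ∷ (a ↑ʳ j) ∷ w , irr (big-Horadam j p)

  data Letter : Fin (a + b) → Set where
    low  : (c : Fin a) → Letter (c ↑ˡ b)
    high : (j : Fin b) → Letter (a ↑ʳ j)

  letter : ∀ x → Letter x
  letter x with splitAt a x in eq
  ... | inj₁ c = subst Letter (splitAt⁻¹-↑ˡ eq) (low c)
  ... | inj₂ j = subst Letter (splitAt⁻¹-↑ʳ eq) (high j)

  -- The decomposition behind the Horadam recursion: a nonempty word is a letter below `a`, or 0
  -- followed by a letter at least `a`, and then a shorter Horadam word.
  data View : ∀ {k} → 𝒮 a b k → Set where
    empty     : View ε
    viewSmall : ∀ {k} c (u : 𝒮 a b k) → View (small c u)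
    viewBig   : ∀ {k} j (u : 𝒮 a b k) → View (big j u)

  view : ∀ {k} (u : 𝒮 a b k) → View u
  view ([] , _) = empty
  view (x ∷ [] , irr p) with letter x
  ... | low c  = viewSmall c ε
  -- The membership proof `p` is irrelevant, so the contradiction has to be eliminated irrelevantly.
  ... | high j = ⊥-elim-irr (high-head j p)
  view (x ∷ y ∷ w , irr p) with letter x | letter y
  ... | low c       | low d  = viewSmall c (_ , irr (small-Horadam⁻ d p))
  ... | low zero    | high j = viewBig j (_ , irr (big-Horadam⁻ j p))
  ... | low (suc c) | high j = ⊥-elim-irr (nonzero-high (c ↑ˡ b) j p)
  ... | high j      | _      = ⊥-elim-irr (high-head j p)

  small-injective : ∀ {k} {c d} {u v : 𝒮 a b k} → small c u ≡ small d v → c ≡ d × u ≡ v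
  small-injective {c = c} {d} eq with c≡d , u≡v ← ∷-injective (cong value eq) =
    ↑ˡ-injective b c d c≡d , value-injective u≡v

  big-injective : ∀ {k} {i j} {u v : 𝒮 a b k} → big i u ≡ big j v → i ≡ j × u ≡ v
  big-injective {i = i} {j} eq with i≡j , u≡v ← ∷-injective (∷-injectiveʳ (cong value eq)) =
    ↑ʳ-injective a i j i≡j , value-injective u≡v

  -- Equality would make `u` begin with a letter at least `a`, but `u` is itself a Horadam word.
  small≢big : ∀ {k} {c j} {u : 𝒮 a b (suc k)} {v} → small c u ≢ big j v
  small≢big {j = j} {u = x ∷ w , irr p} eq
    with refl ← ∷-injectiveˡ (∷-injectiveʳ (cong value eq)) = ⊥-elim-irr (high-head j p)

  Enumerates-small : ∀ {cs us} → Enumerates cs → Enumerates us →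
    Enumerates (cartesianProductWith (small {0}) cs us)
  Enumerates-small {cs} {us} (enumerates uc cc) (enumerates uu cu) =
    enumerates (Unique.cartesianProductWith⁺ small small-injective uc uu) complete
    where
    complete : ∀ u → u ∈ cartesianProductWith small cs us
    complete u with view u
    ... | viewSmall c v = ∈-cartesianProductWith⁺ small (cc c) (cu v)

  Enumerates-small-big : ∀ {k cs js us vs} →
    Enumerates cs → Enumerates js → Enumerates us → Enumerates vs →
    Enumerates (cartesianProductWith (small {suc k}) cs us ++ cartesianProductWith big js vs)
  Enumerates-small-big {k} {cs} {js} {us} {vs}
    (enumerates uc cc) (enumerates uj cj) (enumerates uu cu) (enumerates uv cv) =
    enumerates
      (Unique.++⁺ (Unique.cartesianProductWith⁺ small small-injective uc uu)
                  (Unique.cartesianProductWith⁺ big big-injective uj uv)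
                  disjoint)
      complete
    where
    disjoint : ∀ {u} → ¬ (u ∈ cartesianProductWith small cs us × u ∈ cartesianProductWith big js vs)
    disjoint (u∈ , u∈′)
      with c , u , _ , _ , refl ← ∈-cartesianProductWith⁻ small cs us u∈
      with j , v , _ , _ , eq   ← ∈-cartesianProductWith⁻ big js vs u∈′ =
      small≢big {c = c} {j} {u} {v} eq

    complete : ∀ u → u ∈ cartesianProductWith small cs us ++ cartesianProductWith big js vs
    complete u with view u
    ... | viewSmall c v = ∈-++⁺ˡ (∈-cartesianProductWith⁺ small (cc c) (cu v))
    ... | viewBig j v   = ∈-++⁺ʳ _ (∈-cartesianProductWith⁺ big (cj j) (cv v))

  -- Edges between words built by `small` and `big`

  Adj-small : ∀ {k} c (u v : 𝒮 a b k) → Adj k u v → Adj (suc k) (small c u) (small c v)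
  Adj-small c u v u~v rewrite ∣n-n∣≡0 (toℕ (c ↑ˡ b)) = u~v

  Consecutive⇒Adj-small : ∀ {k} c d (u : 𝒮 a b k) → Consecutive c d →
    Adj (suc k) (small c u) (small d u)
  Consecutive⇒Adj-small c d u c~d
    rewrite toℕ-↑ˡ c b | toℕ-↑ˡ d b | dist-self (value u) = trans (+-identityʳ _) c~d

  top : Fin a
  top = fromℕ a′

  -- Column j consists of the words starting with 0 (a − 1 + j).
  column : ∀ {k} → Fin (suc b) → 𝒮 a b k → 𝒮 a b (2 + k)
  column zero    u = small zero (small top u)
  column (suc j) u = big j u

  columnLetter : Fin (suc b) → Fin (a + b)
  columnLetter zero    = top ↑ˡ b
  columnLetter (suc j) = a ↑ʳ j

  value-column : ∀ {k} j (u : 𝒮 a b k) → value (column j u) ≡ zero ∷ columnLetter j ∷ value u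
  value-column zero    u = refl
  value-column (suc j) u = refl

  -- The second letters of the columns form one run of integers across the boundary between `↑ˡ` and
  -- `↑ʳ`, so neighbouring columns are joined even where a small word meets a big one.
  toℕ-columnLetter : ∀ j → toℕ (columnLetter j) ≡ a′ + toℕ j
  toℕ-columnLetter zero    = trans (toℕ-↑ˡ top b) (trans (toℕ-fromℕ a′) (sym (+-identityʳ a′)))
  toℕ-columnLetter (suc j) = trans (toℕ-↑ʳ a j) (sym (+-suc a′ (toℕ j)))

  Adj-column : ∀ {k} j (u v : 𝒮 a b k) → Adj k u v → Adj (2 + k) (column j u) (column j v)
  Adj-column j u v u~v
    rewrite value-column j u | value-column j v | ∣n-n∣≡0 (toℕ (columnLetter j)) = u~v

  Consecutive⇒Adj-column : ∀ {k} i j (u : 𝒮 a b k) → Consecutive i j →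
    Adj (2 + k) (column i u) (column j u)
  Consecutive⇒Adj-column i j u i~j
    rewrite value-column i u | value-column j u | toℕ-columnLetter i | toℕ-columnLetter j
          | dist-self (value u) =
    trans (+-identityʳ _) (trans (∣m+n-m+o∣≡∣n-o∣ a′ (toℕ i) (toℕ j)) i~j)

  -- The Hamiltonian path and the parity of its length

  mutual
    gray : ∀ k → List (𝒮 a b k)
    gray zero    = [ ε ]
    gray (suc k) = snake small (descending a) (gray k) ++ grayBig k

    -- Kept separate so that `gray (suc k)` unfolds without a case distinction on `k`; words of
    -- length one have no big part.
    grayBig : ∀ k → List (𝒮 a b (suc k))
    grayBig zero    = []
    grayBig (suc k) = snake big (allFin b) (gray k)

  start : ∀ k → 𝒮 a b k
  start zero    = ε
  start (suc k) = small top (start k)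

  gray-enumerates : ∀ k → Enumerates (gray k)
  gray-enumerates zero          = enumerates ([] ∷ []) λ { u → complete u (view u) }
    where
    complete : ∀ u → View u → u ∈ gray zero
    complete _ empty = here refl
  gray-enumerates (suc zero)    = Enumerates-resp-↭
    (↭-sym (↭-trans (↭-reflexive (++-identityʳ _)) (snake-↭ small (descending a) (gray zero))))
    (Enumerates-small (Enumerates-descending a) (gray-enumerates zero))
  gray-enumerates (suc (suc k)) = Enumerates-resp-↭
    (↭-sym (↭-++⁺ (snake-↭ small (descending a) (gray (suc k))) (snake-↭ big (allFin b) (gray k))))
    (Enumerates-small-big (Enumerates-descending a) (Enumerates-allFin b)
      (gray-enumerates (suc k)) (gray-enumerates k))

  -- `descending a` begins with `top`, which makes this the first row of the snake. It is the
  -- segment that the cycle replaces by a detour.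
  gray-prefix : ∀ k → ∃[ us ] gray (suc k) ≡ map (small top) (gray k) ++ us
  gray-prefix k = _ , ++-assoc (map (small top) (gray k)) _ (grayBig k)

  module _ (a-even : parity a ≡ 0ℙ) where

    gray-path : ∀ k → ∃[ e ] Path (Adj k) (start k) e (gray k)
    gray-path zero    = ε , single
    gray-path (suc k) = extend k
      (path-snake {R = Consecutive} (λ {u} {v} → Adj-sym {k} {u} {v}) small
        Consecutive⇒Adj-small Adj-small
        (trans (cong parity (length-tabulate {n = a} opposite)) a-even)
        (path-descending a′) (proj₂ (gray-path k)))
      where
      extend : ∀ k →
        Path (Adj (suc k)) (start (suc k)) (small zero (start k)) (snake small (descending a) (gray k)) →
        ∃[ e ] Path (Adj (suc k)) (start (suc k)) e (gray (suc k))
      extend zero    q = _ , subst (Path _ _ _) (sym (++-identityʳ _)) q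
      extend (suc k) q with e , p ← gray-path k =
        -- `small zero (start (suc k))` unfolds to `column zero (start k)`, so the step to the big
        -- words is one from column 0 to column 1.
        _ , path-++ q (Consecutive⇒Adj-column zero (suc zero) (start k) refl)
          (path-snake {R = Consecutive} (λ {u} {v} → Adj-sym {k} {u} {v}) big
            (λ i j → Consecutive⇒Adj-column (suc i) (suc j)) (λ j → Adj-column (suc j))
            refl (path-tabulate b′ id consecutive-suc) p)

    -- The lengths satisfy the recursion with coefficients `a` and `b`. Modulo 2 the `a` term
    -- vanishes and the length for `k + 2` agrees with that for `k`; the first two lengths are 1 and
    -- `a`.
    parity-gray : parity b ≡ 1ℙ → ∀ k → parity (length (gray k)) ≡ parity (suc k)
    parity-gray b-odd zero    = refl
    parity-gray b-odd (suc k) = begin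
      parity (length (snake small (descending a) (gray k) ++ grayBig k))
        ≡⟨ cong parity (length-++ (snake small (descending a) (gray k))) ⟩
      parity (length (snake small (descending a) (gray k)) + length (grayBig k))
        ≡⟨ +-homo-+ (length (snake small (descending a) (gray k))) _ ⟩
      parity (length (snake small (descending a) (gray k))) Parity.+ parity (length (grayBig k))
        ≡⟨ cong₂ Parity._+_ (parity-snake small opposite (gray k) a-even) (parity-grayBig k) ⟩
      parity k ∎
      where
      open ≡-Reasoning

      parity-snake : ∀ {n p} {A B C : Set} (f : A → B → C) (g : Fin n → A) ys → parity n ≡ p →
        parity (length (snake f (tabulate g) ys)) ≡ p Parity.* parity (length ys)
      parity-snake {n} f g ys refl =
        trans (cong parity (trans (length-snake f (tabulate g) ys)
                                  (cong (_* length ys) (length-tabulate g))))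
              (*-homo-* n (length ys))

      parity-grayBig : ∀ k → parity (length (grayBig k)) ≡ parity k
      parity-grayBig zero    = refl
      parity-grayBig (suc k) = trans
        (parity-snake big id (gray k) b-odd) (parity-gray b-odd k)

-- Folding the big words into a Hamiltonian cycle of the grid

module _ (a″ b′ : ℕ) (a-even : parity a″ ≡ 0ℙ) where
  open Cube (suc a″) b′

  -- Row 0 of the cycle is 0·vs with its initial segment 0(a−1)·us replaced by a
  -- snake through the words 0c·us, c ≥ a − 1.  It is followed by the
  -- rows 1, …, a − 1 without their first column, and that column leads back.
  cycle : ∀ {k us ws s e z} → let vs = map (small top) us ++ ws in
    parity (length us) ≡ 0ℙ → Enumerates us → Enumerates vs →
    Path (Adj k) s e us → Path (Adj (suc k)) (small top s) z vs →
    Hamiltonian (Π-cube a b (2 + k))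
  -- Even length excludes a one-word path, so there is a second word `s′`. Exposing it as the head
  -- of `us′` shows where the rows without their first column begin.
  cycle {k} {_} {ws} {s} {e} {z} us-even us-all vs-all p@(cons {y = s′} {xs = us′} s~s′ p′) q
    with us″ , refl ← path-nonempty p′ =
    hamiltonian (Π-cube a b (2 + k))
      (path-++ path-row₀ (Consecutive⇒Adj-small zero (suc zero) z refl)
        (path-++ path-rows
          (Adj-small top (small top s′) (small top s)
            (Adj-small top s′ s (Adj-sym {k} {s} {s′} s~s′)))
          path-return))
      (Consecutive⇒Adj-small (suc zero) zero (small top s) refl)
      3≤length
      (Enumerates-resp-↭ (↭-sym cycle-↭)
        (Enumerates-small-big (Enumerates-allFin a) (Enumerates-allFin b) vs-all us-all))
    where
    us : List (𝒮 a b k)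
    us = s ∷ us′

    vs vs′ : List (𝒮 a b (suc k))
    vs′ = map (small top) us′ ++ ws
    vs  = small top s ∷ vs′

    nonzero : List (Fin a)
    nonzero = tabulate suc

    folded row₀ rows return : List (𝒮 a b (2 + k))
    folded = snake (flip column) us (allFin (suc b))
    row₀   = folded ++ map (small zero) ws
    rows   = snake small nonzero (reverse vs′)
    return = map (flip small (small top s)) (reverse nonzero)

    path-nonzero : Path Consecutive (suc zero) top nonzero
    path-nonzero = path-tabulate a″ suc consecutive-suc

    -- As `us` has even length, the snake returns to column 0 and ends at the same word as the
    -- segment it replaces.
    path-folded : Path (Adj (2 + k)) (column zero s) (column zero e) folded
    path-folded = path-snake {R = Adj k} (λ {i} {j} → consecutive-sym {x = i} {j}) (flip column)
      (λ u v j → Adj-column j u v) (λ u i j → Consecutive⇒Adj-column i j u)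
      us-even p (path-tabulate b id consecutive-suc)

    path-row₀ : Path (Adj (2 + k)) (column zero s) (small zero z) row₀
    path-row₀ = path-replace-prefix
      (path-map (small zero) (Adj-small zero) (path-map (small top) (Adj-small top) p))
      path-folded
      (subst (Path _ _ _) (map-++ (small zero) (map (small top) us) ws)
        (path-map (small zero) (Adj-small zero) q))

    -- The `a − 1` rows are odd in number, so a snake entering at the `z` end leaves at the `s′`
    -- end, next to the first column.
    path-rows : Path (Adj (2 + k)) (small (suc zero) z) (small top (small top s′)) rows
    path-rows = path-snake {R = Consecutive} (λ {u} {v} → Adj-sym {suc k} {u} {v}) small
      Consecutive⇒Adj-small Adj-small
      odd path-nonzero (path-reverse (λ {u} {v} → Adj-sym {suc k} {u} {v}) (path-tail q))
      where
      odd : parity (length nonzero) ≡ 1ℙ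
      odd = trans (cong parity (length-tabulate {n = suc a″} suc))
                  (trans (sym (suc-homo-⁻¹ (suc a″))) (cong _⁻¹ a-even))

    path-return : Path (Adj (2 + k)) (small top (small top s)) (small (suc zero) (small top s)) return
    path-return = path-map (flip small (small top s))
      (λ c d → Consecutive⇒Adj-small c d (small top s))
      (path-reverse (λ {c} {d} → consecutive-sym {x = c} {d}) path-nonzero)

    3≤length : 3 ≤ length (row₀ ++ rows ++ return)
    3≤length rewrite length-++ row₀ {rows ++ return} | length-++ rows {return} =
      +-mono-≤ (1≤path-length path-row₀)
        (+-mono-≤ (1≤path-length path-rows) (1≤path-length path-return))

    -- Transposing the snake's grid separates column 0, which lies in row 0 of the large grid, from
    -- the columns of big words.
    folded-↭ : folded ↭ map (column zero) us ++ cartesianProductWith big (allFin b) us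
    folded-↭ = begin
      folded
        ↭⟨ snake-↭ (flip column) us (allFin (suc b)) ⟩
      cartesianProductWith (flip column) us (allFin (suc b))
        ↭⟨ cartesianProductWith-flip column (allFin (suc b)) us ⟩
      map (column zero) us ++ cartesianProductWith column (tabulate suc) us
        ≡⟨ cong (λ js → map (column zero) us ++ cartesianProductWith column js us) (map-tabulate id suc) ⟨
      map (column zero) us ++ cartesianProductWith column (map suc (allFin b)) us
        ≡⟨ cong (map (column zero) us ++_) (cartesianProductWith-map column suc (allFin b) us) ⟩
      map (column zero) us ++ cartesianProductWith big (allFin b) us ∎
      where open PermutationReasoning

    rows-return-↭ : rows ++ return ↭ cartesianProductWith small nonzero vs
    rows-return-↭ = begin
      rows ++ return
        ↭⟨ ++-comm rows return ⟩
      return ++ rows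
        ↭⟨ ↭-++⁺ (↭-map⁺ (flip small (small top s)) (↭-reverse nonzero))
                 (↭-trans (snake-↭ small nonzero (reverse vs′))
                          (cartesianProductWith-congʳ small nonzero (↭-reverse vs′))) ⟩
      map (flip small (small top s)) nonzero ++ cartesianProductWith small nonzero vs′
        ↭⟨ cartesianProductWith-∷ʳ small nonzero (small top s) vs′ ⟨
      cartesianProductWith small nonzero vs ∎
      where open PermutationReasoning

    -- Brings the visiting order into the form of `Enumerates-small-big`, so that the cycle meets
    -- every vertex exactly once.
    cycle-↭ : row₀ ++ rows ++ return ↭
      cartesianProductWith small (allFin a) vs ++ cartesianProductWith big (allFin b) us
    cycle-↭ = begin
      (folded ++ map (small zero) ws) ++ rows ++ return
        ↭⟨ ↭-++⁺ (↭-++⁺ folded-↭ ↭-refl) rows-return-↭ ⟩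
      ((map (column zero) us ++ bigs) ++ map (small zero) ws) ++ smalls
        ↭⟨ ++-rotate (map (column zero) us) bigs (map (small zero) ws) smalls ⟩
      ((map (column zero) us ++ map (small zero) ws) ++ smalls) ++ bigs
        ≡⟨ cong (λ l → ((l ++ map (small zero) ws) ++ smalls) ++ bigs) (map-∘ us) ⟩
      ((map (small zero) (map (small top) us) ++ map (small zero) ws) ++ smalls) ++ bigs
        ≡⟨ cong (λ l → (l ++ smalls) ++ bigs) (map-++ (small zero) (map (small top) us) ws) ⟨
      -- Since `allFin a` unfolds to `zero ∷ nonzero`, this already is the required product.
      (map (small zero) vs ++ smalls) ++ bigs ∎
      where
      open PermutationReasoning
      smalls bigs : List (𝒮 a b (2 + k))
      smalls = cartesianProductWith small nonzero vs
      bigs   = cartesianProductWith big (allFin b) us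

theorem16 : (a b n : ℕ) → 1 ≤ a → parity a ≡ 0ℙ → 1 ≤ b → parity b ≡ 1ℙ → 1 < n → parity n ≡ 1ℙ → Hamiltonian (Π-cube a b n)
-- A positive even `a` is at least 2, which provides rows 0 and 1.
theorem16 (suc (suc a″)) (suc b′) (suc (suc k)) _ a-even _ b-odd _ k-odd
  with ws , gray≡ ← Cube.gray-prefix (suc a″) b′ k =
  cycle a″ b′ a-even
    -- The length of `gray k` has the parity of `k + 1`, which is even because `n = k + 2` is odd.
    (trans (parity-gray a-even b-odd k) (trans (sym (suc-homo-⁻¹ (suc k))) (cong _⁻¹ k-odd)))
    (gray-enumerates k)
    (subst Enumerates gray≡ (gray-enumerates (suc k)))
    (proj₂ (gray-path a-even k))
    (subst (Path _ _ _) gray≡ (proj₂ (gray-path a-even (suc k))))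
  where open Cube (suc a″) b′
theorem16 _ _ (suc zero) _ _ _ _ (s≤s ()) _
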